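{- Let $\pi,\pi'\in S_n$ be distinct and let $i\in[2,n-2]$. If $d_i^R(\mathrm{rev}(\pi))=\mathrm{rev}(\pi')$, then $h_{i-1}(\pi)=\pi'$. If $d_i^R(\mathrm{flip}(\pi))=\mathrm{flip}(\pi')$, then $h_{n-i-1}(\pi)=\pi'$.
   Context: Permutations are in one-line notation. $\mathrm{ID}(\pi)$ is the set of $i\in[n-1]$ such that $i$ occurs to the right of $i+1$. $\mathrm{rev}(\pi)$ is $\pi$ read from right to left; $\mathrm{flip}(\pi)$ is obtained from $\mathrm{rev}(\pi)$ by replacing each value $v$ by $n+1-v$. $d_i$ acts on a permutation by: $\ldots i\ldots i-1\ldots i+1\ldots\leftrightarrow\ldots i+1\ldots i-1\ldots i\ldots$ and $\ldots i\ldots i+1\ldots i-1\ldots\leftrightarrow\ldots i-1\ldots i+1\ldots i\ldots$ (all else fixed), and as the identity if $i$ is between $i-1$ and $i+1$. For $i\in[2,n-2]$, $d_i^R(\pi)=\pi$ if $i+1\in\mathrm{ID}(\pi)\cap\mathrm{ID}(d_i(\pi))$, and $d_i^R(\pi)=d_i(\pi)$ otherwise. (Equivalently, $d_i^R$ acts on permutations through its action on the RSK insertion tableau, fixing the recording tableau.) Elementary shifted dual equivalences $h_i$, $1\le i\le n-3$: for $n=4$, $h_1$ swaps the values $x$ and $y$ when the permutation has one of the forms $$1x2y,\ x12y,\ 1x4y,\ x14y,\ 4x1y,\ x41y,\ 4x3y,\ x43y$$ (where $\{x,y\}$ are the two remaining values of $\{1,2,3,4\}$, in either order), and is the identity otherwise.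 For $n>4$, $h_i$ fixes all values outside $I=[i,i+3]$ and permutes the values in $I$ among their positions so that $\mathrm{fl}(h_i(\pi)|_I)=h_1(\mathrm{fl}(\pi|_I))$, where $\pi|_I$ is the subword of values in $I$ and $\mathrm{fl}$ replaces a word by the permutation in the same relative order. -}

module Defs where

open import Data.Bool using (if_then_else_)
open import Data.List using (List; []; _∷_; map; filter; length; reverse; applyUpTo)
open import Data.List.Relation.Binary.Permutation.Propositional using (_↭_)
open import Data.List.Relation.Binary.Sublist.Propositional using (_⊆_)
open import Data.Nat using (ℕ; suc; _+_; _∸_; _≤_; _≤?_; _<?_; _≟_)
open import Data.List.Relation.Binary.Sublist.DecPropositional _≟_ using (_⊆?_)
open import Data.Product using (_×_)
open import Level using (0ℓ)
open import Relation.Nullary using (does; _×-dec_; _⊎-dec_)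
open import Relation.Unary using (Pred; Decidable; _∈_; _∩_)
open import Relation.Unary.Properties using (_∩?_)

-- Permutations are words over the letters 1, …, n (one-line notation).
-- The operations below are total on words; on words outside S n, or on
-- indices outside the stated ranges, their values are irrelevant.

Word : Set
Word = List ℕ

S : ℕ → Pred Word 0ℓ
S n w = w ↭ applyUpTo suc n

flip : ℕ → Word → Word
flip n w = map (suc n ∸_) (reverse w)

-- _⊆_ is the subsequence relation, so this says that i occurs to the
-- right of i + 1.  For w in S n it forces 1 ≤ i ≤ n - 1.
ID : Word → Pred ℕ 0ℓ
ID w i = (i + 1 ∷ i ∷ []) ⊆ w

ID? : (w : Word) → Decidable (ID w)
ID? w i = (i + 1 ∷ i ∷ []) ⊆? w

swapValues : ℕ → ℕ → Word → Word
swapValues a b = map λ v →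
  if does (v ≟ a) then b else if does (v ≟ b) then a else v

-- For 2 ≤ i ≤ n - 1.
d : ℕ → Word → Word
d i w =
  if does (((i ∷ i ∸ 1 ∷ i + 1 ∷ []) ⊆? w) ⊎-dec ((i + 1 ∷ i ∸ 1 ∷ i ∷ []) ⊆? w))
  then swapValues i (i + 1) w
  else
  if does (((i ∷ i + 1 ∷ i ∸ 1 ∷ []) ⊆? w) ⊎-dec ((i ∸ 1 ∷ i + 1 ∷ i ∷ []) ⊆? w))
  then swapValues i (i ∸ 1) w
  else w

-- For 2 ≤ i ≤ n - 2.
dᴿ : ℕ → Word → Word
dᴿ i w = if does ((ID? w ∩? ID? (d i w)) (i + 1)) then w else d i w

-- Each letter becomes its rank; meant for words with distinct letters.
fl : Word → Word
fl w = map (λ v → suc (length (filter (_<? v) w))) w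

I : ℕ → Pred ℕ 0ℓ
I i v = i ≤ v × v ≤ i + 3

I? : ∀ i → Decidable (I i)
I? i v = (i ≤? v) ×-dec (v ≤? i + 3)

restrict : ℕ → Word → Word
restrict i = filter (I? i)

h₁ : Word → Word
h₁ (1 ∷ x ∷ 2 ∷ y ∷ []) = 1 ∷ y ∷ 2 ∷ x ∷ []
h₁ (x ∷ 1 ∷ 2 ∷ y ∷ []) = y ∷ 1 ∷ 2 ∷ x ∷ []
h₁ (1 ∷ x ∷ 4 ∷ y ∷ []) = 1 ∷ y ∷ 4 ∷ x ∷ []
h₁ (x ∷ 1 ∷ 4 ∷ y ∷ []) = y ∷ 1 ∷ 4 ∷ x ∷ []
h₁ (4 ∷ x ∷ 1 ∷ y ∷ []) = 4 ∷ y ∷ 1 ∷ x ∷ []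
h₁ (x ∷ 4 ∷ 1 ∷ y ∷ []) = y ∷ 4 ∷ 1 ∷ x ∷ []
h₁ (4 ∷ x ∷ 3 ∷ y ∷ []) = 4 ∷ y ∷ 3 ∷ x ∷ []
h₁ (x ∷ 4 ∷ 3 ∷ y ∷ []) = y ∷ 4 ∷ 3 ∷ x ∷ []
h₁ w                     = w

-- refill i w u puts the letters of u, in order, at the positions of w
-- that hold letters in I i, and keeps all other letters of w.
refill : ℕ → Word → Word → Word
refill i []      u       = []
refill i (v ∷ w) []      = v ∷ w
refill i (v ∷ w) (x ∷ u) =
  if does (I? i v) then x ∷ refill i w u else v ∷ refill i w (x ∷ u)

-- For 1 ≤ i ≤ n - 3.  The letter of rank r in I i is i + r - 1, so the
-- refilling word is the one with letters in I i that flattens to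
-- h₁ (fl (restrict i w)).  For n = 4 and i = 1 this is h₁ itself.
h : ℕ → Word → Word
h i w = refill i w (map (λ r → i + r ∸ 1) (h₁ (fl (restrict i w))))

{-# OPTIONS --safe #-}
module Submission where

-- The operation dᴿ i depends only on the relative positions of the four letters
-- i − 1, …, i + 2 and only permutes these letters among their positions, so it
-- commutes with restriction to the window and with shifting the window to
-- 1, …, 4.  Complementation carries it to the same operation for the letters
-- n + 2 − i, …, n − i − 1, read downwards.  Both claims thus become statements
-- about the 24 permutations in S 4, where dᴿ in either reading direction does
-- nothing or acts as h₁; in the first case π = π′, which is excluded.

open import Defs
open import Data.Bool using (if_then_else_)
open import Data.Fin using (Fin; toℕ)
open import Data.Fin.Patterns using (0F; 1F; 2F; 3F)
open import Data.List using (List; []; _∷_; _++_; map; filter; length; reverse; applyUpTo)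
open import Data.List.Properties
open import Data.List.Membership.Propositional using () renaming (_∈_ to _∈ˡ_)
open import Data.List.Relation.Unary.All as All using (All; []; _∷_)
open import Data.List.Relation.Unary.All.Properties as All using (applyUpTo⁺₁; applyUpTo⁺₂)
open import Data.List.Relation.Binary.Permutation.Propositional using (_↭_; ↭-sym; ↭-trans; ↭-reflexive)
open import Data.List.Relation.Binary.Permutation.Propositional.Properties
  using (∈-resp-↭; All-resp-↭; ↭-length; ↭-map-inv; filter-↭; ↭-reverse)
open import Data.List.Relation.Binary.Pointwise as Pointwise using (Pointwise; []; _∷_)
open import Data.List.Relation.Binary.Sublist.Propositional using (_⊆_; ⊆-trans)
open import Data.List.Relation.Binary.Sublist.Propositional.Properties using (map⁺; filter-⊆; filter⁺)
open import Data.Nat using (ℕ; zero; suc; _+_; _∸_; _≤_; _≟_; _<?_; z≤n; s≤s)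
open import Data.Nat.Properties
open import Data.List.Membership.DecPropositional _≟_ using (_∈?_)
open import Data.List.Relation.Binary.Sublist.DecPropositional _≟_ using (_⊆?_)
open import Data.Nat.Solver using (module +-*-Solver)
open import Data.Product using (_×_; _,_; proj₁; proj₂; ∃)
open import Data.Product.Function.NonDependent.Propositional using (_×-⇔_)
open import Data.Sum using (_⊎_; inj₁; inj₂)
open import Data.Sum.Function.Propositional using (_⊎-⇔_)
open import Function using (_∘_; _⇔_; mk⇔; Equivalence)
open import Relation.Binary.PropositionalEquality
  using (_≡_; _≢_; refl; sym; trans; cong; cong₂; subst; subst₂; module ≡-Reasoning)
open import Relation.Binary.Definitions using (DecidableEquality)
open import Relation.Nullary using (Dec; yes; no; does; ¬_; contradiction; _×-dec_; _⊎-dec_; _→-dec_)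
open import Relation.Nullary.Decidable using (from-yes; dec-true; dec-false)
open import Relation.Unary using (_∈_; _∉_)
open +-*-Solver using (solve; con; _:+_; _:=_)

-- Braid moves on four named letters and their simulations

_≟ʷ_ : DecidableEquality Word
_≟ʷ_ = ≡-dec _≟_

-- The values playing the roles of i − 1, i, i + 1, i + 2; in particular
-- dᴿ i is definitionally braidᴿ (consecutive i).
Letters : Set
Letters = Fin 4 → ℕ

braid : Letters → Word → Word
braid ℓ w =
  if does ((map ℓ (1F ∷ 0F ∷ 2F ∷ []) ⊆? w) ⊎-dec (map ℓ (2F ∷ 0F ∷ 1F ∷ []) ⊆? w))
  then swapValues (ℓ 1F) (ℓ 2F) w
  else
  if does ((map ℓ (1F ∷ 2F ∷ 0F ∷ []) ⊆? w) ⊎-dec (map ℓ (0F ∷ 2F ∷ 1F ∷ []) ⊆? w))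
  then swapValues (ℓ 1F) (ℓ 0F) w
  else w

braidᴿ : Letters → Word → Word
braidᴿ ℓ w =
  if does ((map ℓ (3F ∷ 2F ∷ []) ⊆? w) ×-dec (map ℓ (3F ∷ 2F ∷ []) ⊆? braid ℓ w))
  then w else braid ℓ w

consecutive : ℕ → Letters
consecutive i 0F = i ∸ 1
consecutive i 1F = i
consecutive i 2F = i + 1
consecutive i 3F = i + 1 + 1

if-related : ∀ {A B : Set} {R : Word → Word → Set} {u v u′ v′} →
  A ⇔ B → (a? : Dec A) (b? : Dec B) → R u u′ → R v v′ →
  R (if does a? then u else v) (if does b? then u′ else v′)
if-related A⇔B (yes a) (yes b) r s = r
if-related A⇔B (yes a) (no ¬b) r s = contradiction (Equivalence.to A⇔B a) ¬b
if-related A⇔B (no ¬a) (yes b) r s = contradiction (Equivalence.from A⇔B b) ¬a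
if-related A⇔B (no ¬a) (no ¬b) r s = s

-- `braidᴿ` looks at a word only through subword tests on its own letters and changes it only by
-- swapping two of these. A relation that respects both therefore survives the whole operation.
record Simulation (ℓ ℓ′ : Letters) (R : Word → Word → Set) : Set where
  field
    subword : ∀ {w w′} → R w w′ → ∀ s → map ℓ s ⊆ w ⇔ map ℓ′ s ⊆ w′
    swapped : ∀ {w w′} → R w w′ → ∀ a b →
      R (swapValues (ℓ a) (ℓ b) w) (swapValues (ℓ′ a) (ℓ′ b) w′)

module _ {ℓ ℓ′ : Letters} {R : Word → Word → Set} (sim : Simulation ℓ ℓ′ R) where
  open Simulation sim

  braid-related : ∀ {w w′} → R w w′ → R (braid ℓ w) (braid ℓ′ w′)
  braid-related {w} {w′} r =
    if-test (1F ∷ 0F ∷ 2F ∷ []) (2F ∷ 0F ∷ 1F ∷ []) (swapped r 1F 2F)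
      (if-test (1F ∷ 2F ∷ 0F ∷ []) (0F ∷ 2F ∷ 1F ∷ []) (swapped r 1F 0F) r)
    where
    if-test : ∀ s t {u v u′ v′} → R u u′ → R v v′ →
      R (if does ((map ℓ s ⊆? w) ⊎-dec (map ℓ t ⊆? w)) then u else v)
        (if does ((map ℓ′ s ⊆? w′) ⊎-dec (map ℓ′ t ⊆? w′)) then u′ else v′)
    if-test s t = if-related {R = R} (subword r s ⊎-⇔ subword r t)
      ((map ℓ s ⊆? w) ⊎-dec (map ℓ t ⊆? w)) ((map ℓ′ s ⊆? w′) ⊎-dec (map ℓ′ t ⊆? w′))

  braidᴿ-related : ∀ {w w′} → R w w′ → R (braidᴿ ℓ w) (braidᴿ ℓ′ w′)
  braidᴿ-related {w} {w′} r =
    if-related {R = R} (subword r s ×-⇔ subword (braid-related r) s)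
      ((map ℓ s ⊆? w) ×-dec (map ℓ s ⊆? braid ℓ w))
      ((map ℓ′ s ⊆? w′) ×-dec (map ℓ′ s ⊆? braid ℓ′ w′))
      r (braid-related r)
    where
    s : List (Fin 4)
    s = 3F ∷ 2F ∷ []

-- Swapping two values

transpose : ℕ → ℕ → ℕ → ℕ
transpose a b v = if does (v ≟ a) then b else if does (v ≟ b) then a else v

if-yes : ∀ {A : Set} {X : Set} (a? : Dec A) {x y : X} → A → (if does a? then x else y) ≡ x
if-yes a? a = cong (if_then _ else _) (dec-true a? a)

if-no : ∀ {A : Set} {X : Set} (a? : Dec A) {x y : X} → ¬ A → (if does a? then x else y) ≡ y
if-no a? ¬a = cong (if_then _ else _) (dec-false a? ¬a)

-- The graph of `transpose`, for case analysis without evaluating the tests. The side condition on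
-- `right` leaves the case `a` = `b` to `left`, as the order of the tests does.
data Transpose (a b : ℕ) : ℕ → ℕ → Set where
  left  : Transpose a b a b
  right : b ≢ a → Transpose a b b a
  other : ∀ {v} → v ≢ a → v ≢ b → Transpose a b v v

transpose-left : ∀ a b → transpose a b a ≡ b
transpose-left a b = if-yes (a ≟ a) refl

transpose-right : ∀ {a b} → b ≢ a → transpose a b b ≡ a
transpose-right {a} {b} b≢a = trans (if-no (b ≟ a) b≢a) (if-yes (b ≟ b) refl)

transpose-other : ∀ {a b v} → v ≢ a → v ≢ b → transpose a b v ≡ v
transpose-other {a} {b} {v} v≢a v≢b = trans (if-no (v ≟ a) v≢a) (if-no (v ≟ b) v≢b)

transpose-view : ∀ a b v → Transpose a b v (transpose a b v)
transpose-view a b v with v ≟ a | v ≟ b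
... | yes refl | _        = subst (Transpose a b a) (sym (transpose-left a b)) left
... | no  v≢a  | yes refl = subst (Transpose a b b) (sym (transpose-right v≢a)) (right v≢a)
... | no  v≢a  | no  v≢b  = subst (Transpose a b v) (sym (transpose-other v≢a v≢b)) (other v≢a v≢b)

-- Injectivity is asked only for the two comparisons made, since complementation by truncated
-- subtraction is injective only on bounded letters.
transpose-natural : ∀ (f : ℕ → ℕ) {a b v} → (f v ≡ f a → v ≡ a) → (f v ≡ f b → v ≡ b) →
  f (transpose a b v) ≡ transpose (f a) (f b) (f v)
transpose-natural f {a} {b} {v} inja injb = natural (transpose-view a b v) inja injb
  where
  natural : ∀ {v v′} → Transpose a b v v′ → (f v ≡ f a → v ≡ a) → (f v ≡ f b → v ≡ b) →
    f v′ ≡ transpose (f a) (f b) (f v)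
  natural left            _    _    = sym (transpose-left (f a) (f b))
  natural (right b≢a)     inja _    = sym (transpose-right (b≢a ∘ inja))
  natural (other v≢a v≢b) inja injb = sym (transpose-other (v≢a ∘ inja) (v≢b ∘ injb))

Transpose-preserves : ∀ {P : ℕ → Set} {a b v v′} → P a → P b → Transpose a b v v′ → P v → P v′
Transpose-preserves pa pb left        pv = pb
Transpose-preserves pa pb (right _)   pv = pa
Transpose-preserves pa pb (other _ _) pv = pv

map-swapValues : ∀ (f : ℕ → ℕ) a b {w} →
  All (λ v → (f v ≡ f a → v ≡ a) × (f v ≡ f b → v ≡ b)) w →
  map f (swapValues a b w) ≡ swapValues (f a) (f b) (map f w)
map-swapValues f a b []            = refl
map-swapValues f a b ((p , q) ∷ r) = cong₂ _∷_ (transpose-natural f p q) (map-swapValues f a b r)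

-- Agreement outside a window

-- Both words have their window letters at the same positions, so either can serve as the template
-- from which `refill` rebuilds the other.
Agree : ℕ → Word → Word → Set
Agree i = Pointwise (λ v v′ → v ≡ v′ ⊎ (v ∈ I i × v′ ∈ I i))

Agree-refl : ∀ {i w} → Agree i w w
Agree-refl = Pointwise.refl (inj₁ refl)

Agree-trans : ∀ {i u v w} → Agree i u v → Agree i v w → Agree i u w
Agree-trans {i} = Pointwise.transitive step
  where
  step : ∀ {a b c} → a ≡ b ⊎ (a ∈ I i × b ∈ I i) → b ≡ c ⊎ (b ∈ I i × c ∈ I i) →
    a ≡ c ⊎ (a ∈ I i × c ∈ I i)
  step (inj₁ refl)    q              = q
  step (inj₂ p)       (inj₁ refl)    = inj₂ p
  step (inj₂ (p , _)) (inj₂ (_ , q)) = inj₂ (p , q)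

Agree-Transpose : ∀ {i a b v v′} → a ∈ I i → b ∈ I i → Transpose a b v v′ →
  v ≡ v′ ⊎ (v ∈ I i × v′ ∈ I i)
Agree-Transpose a∈ b∈ left        = inj₂ (a∈ , b∈)
Agree-Transpose a∈ b∈ (right _)   = inj₂ (b∈ , a∈)
Agree-Transpose a∈ b∈ (other _ _) = inj₁ refl

Agree-swapValues : ∀ {i a b} → a ∈ I i → b ∈ I i → ∀ w → Agree i w (swapValues a b w)
Agree-swapValues a∈ b∈ []      = []
Agree-swapValues {a = a} {b} a∈ b∈ (v ∷ w) =
  Agree-Transpose a∈ b∈ (transpose-view a b v) ∷ Agree-swapValues a∈ b∈ w

-- A swap of two window letters takes no position into or out of the window.
restrict-swapValues : ∀ {i a b} → a ∈ I i → b ∈ I i → ∀ w →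
  restrict i (swapValues a b w) ≡ swapValues a b (restrict i w)
restrict-swapValues a∈ b∈ [] = refl
restrict-swapValues {i} {a} {b} a∈ b∈ (v ∷ w) with I? i v
... | yes v∈ = begin
  restrict i (swapValues a b (v ∷ w))
    ≡⟨ filter-accept (I? i) (Transpose-preserves {P = I i} a∈ b∈ (transpose-view a b v) v∈) ⟩
  transpose a b v ∷ restrict i (swapValues a b w)
    ≡⟨ cong (_ ∷_) (restrict-swapValues a∈ b∈ w) ⟩
  swapValues a b (v ∷ restrict i w)
    ≡⟨ cong (swapValues a b) (filter-accept (I? i) v∈) ⟨
  swapValues a b (restrict i (v ∷ w)) ∎
  where open ≡-Reasoning
... | no  v∉ = begin
  restrict i (swapValues a b (v ∷ w))
    ≡⟨ filter-reject (I? i) v′∉ ⟩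
  restrict i (swapValues a b w)
    ≡⟨ restrict-swapValues a∈ b∈ w ⟩
  swapValues a b (restrict i w)
    ≡⟨ cong (swapValues a b) (filter-reject (I? i) v∉) ⟨
  swapValues a b (restrict i (v ∷ w)) ∎
  where
  open ≡-Reasoning
  v′∉ : transpose a b v ∉ I i
  v′∉ v′∈ with Agree-Transpose a∈ b∈ (transpose-view a b v)
  ... | inj₁ v≡v′     = v∉ (subst (_∈ I i) (sym v≡v′) v′∈)
  ... | inj₂ (v∈ , _) = v∉ v∈

-- Refilling the window

refill-[] : ∀ i w → refill i w [] ≡ w
refill-[] i []      = refl
refill-[] i (v ∷ w) = refl

refill-accept : ∀ {i v x} → v ∈ I i → ∀ w u → refill i (v ∷ w) (x ∷ u) ≡ x ∷ refill i w u
refill-accept {i} {v} v∈ w u = if-yes (I? i v) v∈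

refill-reject : ∀ {i v} → v ∉ I i → ∀ w u → refill i (v ∷ w) u ≡ v ∷ refill i w u
-- With no letters left, `refill` returns the rest of the word unchanged.
refill-reject {i} {v} v∉ w []      = cong (v ∷_) (sym (refill-[] i w))
refill-reject {i} {v} v∉ w (x ∷ u) = if-no (I? i v) v∉

-- The window positions coincide, so the window letters of `w′` return to the places they were taken
-- from; elsewhere the two words are equal.
refill-restrict : ∀ {i w w′} → Agree i w w′ → refill i w (restrict i w′) ≡ w′
refill-restrict [] = refl
refill-restrict {i} {v ∷ w} (inj₁ refl ∷ r) with I? i v
... | yes v∈ = trans (cong (refill i (v ∷ w)) (filter-accept (I? i) v∈))
                 (trans (refill-accept v∈ w _) (cong (v ∷_) (refill-restrict r)))
... | no  v∉ = trans (cong (refill i (v ∷ w)) (filter-reject (I? i) v∉))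
                 (trans (refill-reject v∉ w _) (cong (v ∷_) (refill-restrict r)))
refill-restrict {i} {v ∷ w} {v′ ∷ w′} (inj₂ (v∈ , v′∈) ∷ r) =
  trans (cong (refill i (v ∷ w)) (filter-accept (I? i) v′∈))
    (trans (refill-accept v∈ w _) (cong (v′ ∷_) (refill-restrict r)))

restrict-reverse : ∀ i w → restrict i (reverse w) ≡ reverse (restrict i w)
restrict-reverse i []      = refl
restrict-reverse i (v ∷ w) = begin
  restrict i (reverse (v ∷ w))                  ≡⟨ cong (restrict i) (unfold-reverse v w) ⟩
  restrict i (reverse w ++ v ∷ [])              ≡⟨ filter-++ (I? i) (reverse w) _ ⟩
  restrict i (reverse w) ++ restrict i (v ∷ []) ≡⟨ cong (_++ _) (restrict-reverse i w) ⟩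
  reverse (restrict i w) ++ restrict i (v ∷ []) ≡⟨ last ⟩
  reverse (restrict i (v ∷ w))                  ∎
  where
  open ≡-Reasoning
  last : reverse (restrict i w) ++ restrict i (v ∷ []) ≡ reverse (restrict i (v ∷ w))
  last with I? i v
  ... | yes v∈ = trans (cong (reverse (restrict i w) ++_) (filter-accept (I? i) v∈))
                   (trans (sym (unfold-reverse v (restrict i w)))
                     (cong reverse (sym (filter-accept (I? i) v∈))))
  ... | no  v∉ = trans (cong (reverse (restrict i w) ++_) (filter-reject (I? i) v∉))
                   (trans (++-identityʳ _) (cong reverse (sym (filter-reject (I? i) v∉))))

-- The window of a permutation

count-<-shift : ∀ k v u → length (filter (_<? (k + v)) (map (k +_) u)) ≡ length (filter (_<? v) u)
count-<-shift k v [] = refl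
count-<-shift k v (x ∷ u) with x <? v
... | yes x<v = begin
  length (filter (_<? (k + v)) (map (k +_) (x ∷ u)))
    ≡⟨ cong length (filter-accept (_<? (k + v)) (+-monoʳ-< k x<v)) ⟩
  suc (length (filter (_<? (k + v)) (map (k +_) u)))
    ≡⟨ cong suc (count-<-shift k v u) ⟩
  suc (length (filter (_<? v) u))
    ≡⟨ cong length (filter-accept (_<? v) x<v) ⟨
  length (filter (_<? v) (x ∷ u)) ∎
  where open ≡-Reasoning
... | no x≮v = begin
  length (filter (_<? (k + v)) (map (k +_) (x ∷ u)))
    ≡⟨ cong length (filter-reject (_<? (k + v)) (x≮v ∘ +-cancelˡ-< k x v)) ⟩
  length (filter (_<? (k + v)) (map (k +_) u))
    ≡⟨ count-<-shift k v u ⟩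
  length (filter (_<? v) u)
    ≡⟨ cong length (filter-reject (_<? v) x≮v) ⟨
  length (filter (_<? v) (x ∷ u)) ∎
  where open ≡-Reasoning

fl-shift : ∀ k u → fl (map (k +_) u) ≡ fl u
fl-shift k u = trans (sym (map-∘ u)) (map-cong (λ v → cong suc (count-<-shift k v u)) u)

applyUpTo-+ : ∀ {A : Set} (f : ℕ → A) m n →
  applyUpTo f (m + n) ≡ applyUpTo f m ++ applyUpTo (f ∘ (m +_)) n
applyUpTo-+ f zero    n = refl
applyUpTo-+ f (suc m) n = cong (f 0 ∷_) (applyUpTo-+ (f ∘ suc) m n)

shift-I : ∀ k {v} → v ∈ I 1 → k + v ∈ I (suc k)
shift-I k {v} (1≤v , v≤4) =
  subst (_≤ k + v) (+-comm k 1) (+-monoʳ-≤ k 1≤v) ,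
  subst (k + v ≤_) (+-suc k 3) (+-monoʳ-≤ k v≤4)

-- The identity is cut into `k` letters below the window, four inside and `m` above; only the middle
-- block survives.
restrict-identity : ∀ k m →
  restrict (suc k) (applyUpTo suc (k + (4 + m))) ≡ map (k +_) (applyUpTo suc 4)
restrict-identity k m = begin
  restrict (suc k) (applyUpTo suc (k + (4 + m)))
    ≡⟨ cong (restrict (suc k)) (applyUpTo-+ suc k (4 + m)) ⟩
  restrict (suc k) (applyUpTo suc k ++ middle ++ applyUpTo _ m)
    ≡⟨ filter-++ (I? (suc k)) (applyUpTo suc k) _ ⟩
  restrict (suc k) (applyUpTo suc k) ++ restrict (suc k) (middle ++ applyUpTo _ m)
    ≡⟨ cong₂ _++_ (filter-none (I? (suc k)) below) (filter-++ (I? (suc k)) middle _) ⟩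
  restrict (suc k) middle ++ restrict (suc k) (applyUpTo _ m)
    ≡⟨ cong₂ _++_ (filter-all (I? (suc k)) (subst (All (_∈ I (suc k))) (sym middle≡) inside))
                  (filter-none (I? (suc k)) above) ⟩
  middle ++ []
    ≡⟨ ++-identityʳ middle ⟩
  middle
    ≡⟨ middle≡ ⟩
  map (k +_) (applyUpTo suc 4) ∎
  where
  open ≡-Reasoning
  middle : Word
  middle = applyUpTo (suc ∘ (k +_)) 4
  middle≡ : middle ≡ map (k +_) (applyUpTo suc 4)
  middle≡ = sym (map-cong (+-suc k) (0 ∷ 1 ∷ 2 ∷ 3 ∷ []))
  inside : All (_∈ I (suc k)) (map (k +_) (applyUpTo suc 4))
  inside = All.map⁺ (All.map (shift-I k) (from-yes (All.all? (I? 1) (applyUpTo suc 4))))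
  below : All (_∉ I (suc k)) (applyUpTo suc k)
  below = applyUpTo⁺₁ suc k (λ v<k v∈ → <⇒≱ v<k (≤-pred (proj₁ v∈)))
  above : All (_∉ I (suc k)) (applyUpTo (λ v → suc (k + (4 + v))) m)
  above = applyUpTo⁺₂ _ m (λ v v∈ →
    <⇒≱ (+-monoʳ-< k {3} {4 + v} (s≤s (s≤s (s≤s (s≤s z≤n))))) (≤-pred (proj₂ v∈)))

-- Filtering respects `↭`, so the window of `π` rearranges that of the identity; `↭-map-inv` then
-- removes the shift.
restrict-permutation : ∀ k m {π} → π ∈ S (k + (4 + m)) →
  ∃ λ u → restrict (suc k) π ≡ map (k +_) u × u ∈ S 4
restrict-permutation k m {π} π∈S =
  let u , eq , perm = ↭-map-inv (k +_) (↭-sym (↭-trans (filter-↭ (I? (suc k)) π∈S)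
                        (↭-reflexive (restrict-identity k m))))
  in u , eq , ↭-sym perm

-- Permutations of four letters

-- The window letters upwards, for `reverse`, and downwards, for `flip`, whose complementation
-- reverses the order of the values.
ascending descending : Letters
ascending  a = suc (toℕ a)
descending a = 4 ∸ toℕ a

-- The first component makes flattening harmless. The first alternative of the second is needed: on
-- the reversal of 3124 with ascending letters `braidᴿ` does nothing, although `h₁` moves 3124.
Compatible : Letters → Word → Set
Compatible ψ u = fl u ≡ u ×
  (braidᴿ ψ (reverse u) ≡ reverse u ⊎ braidᴿ ψ (reverse u) ≡ reverse (h₁ u))

compatible? : ∀ ψ u → Dec (Compatible ψ u)
compatible? ψ u = (fl u ≟ʷ u) ×-dec
  ((braidᴿ ψ (reverse u) ≟ʷ reverse u) ⊎-dec (braidᴿ ψ (reverse u) ≟ʷ reverse (h₁ u)))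

-- Among the 256 words of length 4 over 1, …, 4, the permutations are those in
-- which every letter occurs.
CompatibleS₄ : Letters → Set
CompatibleS₄ ψ =
  All (λ a → All (λ b → All (λ c → All (λ e →
    All (_∈ˡ (a ∷ b ∷ c ∷ e ∷ [])) (applyUpTo suc 4) → Compatible ψ (a ∷ b ∷ c ∷ e ∷ []))
    (applyUpTo suc 4)) (applyUpTo suc 4)) (applyUpTo suc 4)) (applyUpTo suc 4)

compatibleS₄? : ∀ ψ → Dec (CompatibleS₄ ψ)
compatibleS₄? ψ =
  All.all? (λ a → All.all? (λ b → All.all? (λ c → All.all? (λ e →
    All.all? (_∈? (a ∷ b ∷ c ∷ e ∷ [])) (applyUpTo suc 4) →-dec compatible? ψ (a ∷ b ∷ c ∷ e ∷ []))
    (applyUpTo suc 4)) (applyUpTo suc 4)) (applyUpTo suc 4)) (applyUpTo suc 4)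

ascending-compatible : CompatibleS₄ ascending
ascending-compatible = from-yes (compatibleS₄? ascending)

descending-compatible : CompatibleS₄ descending
descending-compatible = from-yes (compatibleS₄? descending)

compatible : ∀ {ψ u} → CompatibleS₄ ψ → u ∈ S 4 → Compatible ψ u
compatible {ψ} {u} cs u∈S
  -- The length forces four letters, each is one of 1, ..., 4, and all of these occur: exactly the
  -- data over which the finite check quantifies.
  with u | ↭-length u∈S
     | All-resp-↭ (↭-sym u∈S) (All.tabulate {xs = applyUpTo suc 4} (λ v∈ → v∈))
     | All.tabulate {xs = applyUpTo suc 4} (∈-resp-↭ (↭-sym u∈S))
... | a ∷ b ∷ c ∷ e ∷ [] | refl | a∈ ∷ b∈ ∷ c∈ ∷ e∈ ∷ [] | onto =
  All.lookup (All.lookup (All.lookup (All.lookup cs a∈) b∈) c∈) e∈ onto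

-- Simulations by the window and by the complement

-- The start `w₀` is carried along, so that the word reached is known to differ from it only in the
-- window.
WindowOf : ℕ → Word → Word → Word → Set
WindowOf k w₀ w v = Agree (suc k) w₀ w × restrict (suc k) w ≡ map (k +_) v

-- All letters involved lie in the window, so subwords in them survive restriction and swaps of them
-- leave the rest of the word alone; the shift by `k` is injective.
window-simulation : ∀ {k w₀} {ψ ℓ : Letters} → (∀ a → ψ a ∈ I 1) → (∀ a → ℓ a ≡ k + ψ a) →
  Simulation ℓ ψ (WindowOf k w₀)
window-simulation {k} {w₀} {ψ} {ℓ} ψ∈ ℓ≡ = record { subword = sub ; swapped = swp }
  where
  open ≡-Reasoning
  ℓ∈ : ∀ a → ℓ a ∈ I (suc k)
  ℓ∈ a = subst (_∈ I (suc k)) (sym (ℓ≡ a)) (shift-I k (ψ∈ a))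

  map-ℓ : ∀ s → map ℓ s ≡ map (k +_) (map ψ s)
  map-ℓ s = trans (map-cong ℓ≡ s) (map-∘ s)

  unshift : ∀ v → map (_∸ k) (map (k +_) v) ≡ v
  unshift v = trans (sym (map-∘ v)) (map-id-local (All.universal (m+n∸m≡n k) v))

  sub : ∀ {w v} → WindowOf k w₀ w v → ∀ s → map ℓ s ⊆ w ⇔ map ψ s ⊆ v
  sub {w} {v} (_ , w≡) s = mk⇔ to from
    where
    to : map ℓ s ⊆ w → map ψ s ⊆ v
    to s⊆w = subst₂ _⊆_ (unshift _) (unshift v)
      (map⁺ (_∸ k) (subst₂ _⊆_
        (trans (filter-all (I? (suc k)) (All.map⁺ (All.universal ℓ∈ s))) (map-ℓ s)) w≡
        (filter⁺ (I? (suc k)) (I? (suc k)) (λ { refl v∈ → v∈ }) s⊆w)))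
    from : map ψ s ⊆ v → map ℓ s ⊆ w
    from s⊆v = ⊆-trans (subst₂ _⊆_ (sym (map-ℓ s)) (sym w≡) (map⁺ (k +_) s⊆v))
      (filter-⊆ (I? (suc k)) w)

  swp : ∀ {w v} → WindowOf k w₀ w v → ∀ a b →
    WindowOf k w₀ (swapValues (ℓ a) (ℓ b) w) (swapValues (ψ a) (ψ b) v)
  swp {w} {v} (agree , w≡) a b =
    Agree-trans agree (Agree-swapValues (ℓ∈ a) (ℓ∈ b) w) , (begin
    restrict (suc k) (swapValues (ℓ a) (ℓ b) w)
      ≡⟨ restrict-swapValues (ℓ∈ a) (ℓ∈ b) w ⟩
    swapValues (ℓ a) (ℓ b) (restrict (suc k) w)
      ≡⟨ cong (swapValues (ℓ a) (ℓ b)) w≡ ⟩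
    swapValues (ℓ a) (ℓ b) (map (k +_) v)
      ≡⟨ cong₂ (λ x y → swapValues x y (map (k +_) v)) (ℓ≡ a) (ℓ≡ b) ⟩
    swapValues (k + ψ a) (k + ψ b) (map (k +_) v)
      ≡⟨ map-swapValues (k +_) (ψ a) (ψ b)
           (All.universal (λ x → +-cancelˡ-≡ k x (ψ a) , +-cancelˡ-≡ k x (ψ b)) v) ⟨
    map (k +_) (swapValues (ψ a) (ψ b) v) ∎)

-- One argument serves both claims, with ascending letters for `reverse` and descending ones for
-- `flip`: the simulation reduces the move to the window, where the finite check applies.
braidᴿ-reverse⇒h : ∀ {ψ ℓ : Letters} k m {π π′} → π ∈ S (k + (4 + m)) → π ≢ π′ →
  (∀ a → ψ a ∈ I 1) → CompatibleS₄ ψ → (∀ a → ℓ a ≡ k + ψ a) →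
  braidᴿ ℓ (reverse π) ≡ reverse π′ → h (suc k) π ≡ π′
braidᴿ-reverse⇒h {ψ} {ℓ} k m {π} {π′} π∈S π≢π′ ψ∈ cs ℓ≡ eq
  with u , π≡ , u∈S ← restrict-permutation k m π∈S
  with fl≡ , outcome ← compatible {ψ} {u} cs u∈S = conclude outcome
  where
  open ≡-Reasoning
  r₀ : restrict (suc k) (reverse π) ≡ map (k +_) (reverse u)
  r₀ = trans (restrict-reverse (suc k) π) (trans (cong reverse π≡) (sym (reverse-map (k +_) u)))

  r₁ : WindowOf k (reverse π) (reverse π′) (braidᴿ ψ (reverse u))
  r₁ = subst (λ w → WindowOf k (reverse π) w _) eq
    (braidᴿ-related (window-simulation ψ∈ ℓ≡) (Agree-refl , r₀))

  conclude : braidᴿ ψ (reverse u) ≡ reverse u ⊎ braidᴿ ψ (reverse u) ≡ reverse (h₁ u) →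
    h (suc k) π ≡ π′
  -- If the window word is fixed, `π′` has the window of `π` and agrees with it elsewhere, so the
  -- two are equal, against the hypothesis.
  conclude (inj₁ same) = contradiction (reverse-injective (begin
    reverse π
      ≡⟨ refill-restrict Agree-refl ⟨
    refill (suc k) (reverse π) (restrict (suc k) (reverse π))
      ≡⟨ cong (refill (suc k) (reverse π)) (trans r₀ (cong (map (k +_)) (sym same))) ⟩
    refill (suc k) (reverse π) (map (k +_) (braidᴿ ψ (reverse u)))
      ≡⟨ cong (refill (suc k) (reverse π)) (proj₂ r₁) ⟨
    refill (suc k) (reverse π) (restrict (suc k) (reverse π′))
      ≡⟨ refill-restrict (proj₁ r₁) ⟩
    reverse π′ ∎)) π≢π′
  conclude (inj₂ moved) = begin
    -- For `i = suc k` the letter `i + r ∸ 1` in `h` reduces to `k + r`.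
    refill (suc k) π (map (k +_) (h₁ (fl (restrict (suc k) π))))
      ≡⟨ cong (λ v → refill (suc k) π (map (k +_) (h₁ v)))
           (trans (cong fl π≡) (trans (fl-shift k u) fl≡)) ⟩
    refill (suc k) π (map (k +_) (h₁ u))
      ≡⟨ cong (refill (suc k) π) (reverse-injective restrict-π′) ⟨
    refill (suc k) π (restrict (suc k) π′)
      -- The simulation compares the reversed words; reversing once more gives agreement of `π` and
      -- `π′`.
      ≡⟨ refill-restrict (subst₂ (Agree (suc k)) (reverse-involutive π) (reverse-involutive π′)
           (Pointwise.reverse⁺ (proj₁ r₁))) ⟩
    π′ ∎
    where
    restrict-π′ : reverse (restrict (suc k) π′) ≡ reverse (map (k +_) (h₁ u))
    restrict-π′ = begin
      reverse (restrict (suc k) π′)   ≡⟨ restrict-reverse (suc k) π′ ⟨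
      restrict (suc k) (reverse π′)   ≡⟨ proj₂ r₁ ⟩
      map (k +_) (braidᴿ ψ (reverse u)) ≡⟨ cong (map (k +_)) moved ⟩
      map (k +_) (reverse (h₁ u))     ≡⟨ reverse-map (k +_) (h₁ u) ⟩
      reverse (map (k +_) (h₁ u))     ∎

-- The bound travels with the equation because truncated subtraction from `suc n` is its own inverse
-- only on letters up to `suc n`.
ComplementOf : ℕ → Word → Word → Set
ComplementOf n w w′ = All (_≤ suc n) w × w′ ≡ map (suc n ∸_) w

complement-involutive : ∀ {n w} → All (_≤ suc n) w → map (suc n ∸_) (map (suc n ∸_) w) ≡ w
complement-involutive {n} {w} w≤ = trans (sym (map-∘ w)) (map-id-local (All.map m∸[m∸n]≡n w≤))

complement-simulation : ∀ {n} {ℓ ℓ′ : Letters} → (∀ a → ℓ a ≤ suc n) →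
  (∀ a → ℓ′ a ≡ suc n ∸ ℓ a) → Simulation ℓ ℓ′ (ComplementOf n)
complement-simulation {n} {ℓ} {ℓ′} ℓ≤ ℓ′≡ = record { subword = sub ; swapped = swp }
  where
  open ≡-Reasoning
  map-ℓ′ : ∀ s → map ℓ′ s ≡ map (suc n ∸_) (map ℓ s)
  map-ℓ′ s = trans (map-cong ℓ′≡ s) (map-∘ s)

  sub : ∀ {w w′} → ComplementOf n w w′ → ∀ s → map ℓ s ⊆ w ⇔ map ℓ′ s ⊆ w′
  sub {w} (w≤ , refl) s = mk⇔
    (λ s⊆w → subst (_⊆ _) (sym (map-ℓ′ s)) (map⁺ (suc n ∸_) s⊆w))
    (λ s⊆w′ → subst₂ _⊆_
      (trans (cong (map (suc n ∸_)) (map-ℓ′ s))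
        (complement-involutive (All.map⁺ (All.universal ℓ≤ s))))
      (complement-involutive w≤) (map⁺ (suc n ∸_) s⊆w′))

  swp : ∀ {w w′} → ComplementOf n w w′ → ∀ a b →
    ComplementOf n (swapValues (ℓ a) (ℓ b) w) (swapValues (ℓ′ a) (ℓ′ b) w′)
  swp {w} (w≤ , refl) a b =
    All.map⁺ (All.map (λ {v} →
      Transpose-preserves {P = _≤ suc n} (ℓ≤ a) (ℓ≤ b) (transpose-view (ℓ a) (ℓ b) v)) w≤) ,
    (begin
    swapValues (ℓ′ a) (ℓ′ b) (map (suc n ∸_) w)
      ≡⟨ cong₂ (λ x y → swapValues x y (map (suc n ∸_) w)) (ℓ′≡ a) (ℓ′≡ b) ⟩
    swapValues (suc n ∸ ℓ a) (suc n ∸ ℓ b) (map (suc n ∸_) w)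
      ≡⟨ map-swapValues (suc n ∸_) (ℓ a) (ℓ b)
           (All.map (λ v≤ → ∸-cancelˡ-≡ v≤ (ℓ≤ a) , ∸-cancelˡ-≡ v≤ (ℓ≤ b)) w≤) ⟨
    map (suc n ∸_) (swapValues (ℓ a) (ℓ b) w) ∎)

reverse-letters≤ : ∀ {n w} → w ∈ S n → All (_≤ suc n) (reverse w)
reverse-letters≤ {n} {w} w∈S = All-resp-↭ (↭-sym (↭-trans (↭-reverse w) w∈S))
  (applyUpTo⁺₁ suc n m≤n⇒m≤1+n)

-- By the simulation, the move of `ℓ′` on `flip n π` is the complement of the move of `ℓ` on
-- `reverse π`; it remains to complement the hypothesis.
braidᴿ-flip⇒braidᴿ-reverse : ∀ {n π π′} {ℓ ℓ′ : Letters} → π ∈ S n → π′ ∈ S n →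
  (∀ a → ℓ a ≤ suc n) → (∀ a → ℓ′ a ≡ suc n ∸ ℓ a) →
  braidᴿ ℓ′ (flip n π) ≡ flip n π′ → braidᴿ ℓ (reverse π) ≡ reverse π′
braidᴿ-flip⇒braidᴿ-reverse {n} {π} {π′} {ℓ} {ℓ′} π∈S π′∈S ℓ≤ ℓ′≡ eq = begin
  braidᴿ ℓ (reverse π)                                    ≡⟨ complement-involutive b≤ ⟨
  map (suc n ∸_) (map (suc n ∸_) (braidᴿ ℓ (reverse π)))  ≡⟨ cong (map (suc n ∸_)) b≡ ⟨
  map (suc n ∸_) (braidᴿ ℓ′ (flip n π))                   ≡⟨ cong (map (suc n ∸_)) eq ⟩
  map (suc n ∸_) (flip n π′)                              ≡⟨ complement-involutive (reverse-letters≤ π′∈S) ⟩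
  reverse π′                                              ∎
  where
  open ≡-Reasoning
  r : ComplementOf n (braidᴿ ℓ (reverse π)) (braidᴿ ℓ′ (flip n π))
  r = braidᴿ-related (complement-simulation ℓ≤ ℓ′≡) (reverse-letters≤ π∈S , refl)
  b≤ = proj₁ r
  b≡ = proj₂ r

-- The window letters counted from either end

consecutive-ascending : ∀ k a → consecutive (2 + k) a ≡ k + ascending a
consecutive-ascending k 0F = +-comm 1 k
consecutive-ascending k 1F = +-comm 2 k
consecutive-ascending k 2F = trans (+-comm (2 + k) 1) (+-comm 3 k)
consecutive-ascending k 3F = trans (+-assoc (2 + k) 1 1) (trans (+-comm (2 + k) 2) (+-comm 4 k))

-- For `n = k + (4 + m)`, letters in the same role add up to `n + 1`, so complementation exchanges
-- them.
ascending+descending : ∀ k m a → (m + descending a) + (k + ascending a) ≡ suc (k + (4 + m))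
ascending+descending k m a = begin
  (m + descending a) + (k + ascending a)
    ≡⟨ solve 4 (λ k m x y → (m :+ x) :+ (k :+ y) := k :+ ((x :+ y) :+ m))
         refl k m (descending a) (ascending a) ⟩
  k + ((descending a + ascending a) + m)
    ≡⟨ cong (λ s → k + (s + m)) (sum a) ⟩
  k + (5 + m)
    ≡⟨ +-suc k (4 + m) ⟩
  suc (k + (4 + m)) ∎
  where
  open ≡-Reasoning
  sum : ∀ a → descending a + ascending a ≡ 5
  sum 0F = refl
  sum 1F = refl
  sum 2F = refl
  sum 3F = refl

consecutive-descending : ∀ k m a →
  consecutive (2 + k) a ≡ suc (k + (4 + m)) ∸ (m + descending a)
consecutive-descending k m a = begin
  consecutive (2 + k) a
    ≡⟨ consecutive-ascending k a ⟩
  k + ascending a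
    ≡⟨ m+n∸m≡n (m + descending a) _ ⟨
  (m + descending a) + (k + ascending a) ∸ (m + descending a)
    ≡⟨ cong (_∸ (m + descending a)) (ascending+descending k m a) ⟩
  suc (k + (4 + m)) ∸ (m + descending a) ∎
  where open ≡-Reasoning

ascending∈I : ∀ a → ascending a ∈ I 1
ascending∈I 0F = from-yes (I? 1 1)
ascending∈I 1F = from-yes (I? 1 2)
ascending∈I 2F = from-yes (I? 1 3)
ascending∈I 3F = from-yes (I? 1 4)

descending∈I : ∀ a → descending a ∈ I 1
descending∈I 0F = from-yes (I? 1 4)
descending∈I 1F = from-yes (I? 1 3)
descending∈I 2F = from-yes (I? 1 2)
descending∈I 3F = from-yes (I? 1 1)

-- `k` letters lie below the window from `i − 1` to `i + 2` and `m` above it; complementation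
-- exchanges these two numbers.
parametrize : ∀ n i → 2 ≤ i → i ≤ n ∸ 2 →
  ∃ λ k → ∃ λ m → i ≡ 2 + k × n ≡ k + (4 + m)
-- For `n` below 2 the truncated bound `n ∸ 2` is 0, which excludes every `i` from 2 on.
parametrize (suc (suc n)) (suc (suc k)) (s≤s (s≤s z≤n)) i≤ =
  let m , eq = m≤n⇒∃[o]m+o≡n i≤
  in k , m , refl , trans (cong (2 +_) (sym eq))
       (solve 2 (λ k m → con 2 :+ (con 2 :+ k :+ m) := k :+ (con 4 :+ m)) refl k m)

proposition4p4 : ∀ (n : ℕ) (π π′ : Word) → π ∈ S n → π′ ∈ S n → π ≢ π′ →
    ∀ (i : ℕ) → 2 ≤ i → i ≤ n ∸ 2 →
    (dᴿ i (reverse π) ≡ reverse π′ → h (i ∸ 1) π ≡ π′)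
    × (dᴿ i (flip n π) ≡ flip n π′ → h (n ∸ i ∸ 1) π ≡ π′)
proposition4p4 n π π′ π∈S π′∈S π≢π′ i 2≤i i≤n-2
  with k , m , refl , refl ← parametrize n i 2≤i i≤n-2 =
    braidᴿ-reverse⇒h k m π∈S π≢π′ ascending∈I ascending-compatible (consecutive-ascending k)
  -- For `flip` the window runs from `m + 1` to `m + 4`, so `k` and `m` change places and the
  -- letters are read downwards.
  , λ eq → subst (λ j → h j π ≡ π′) (sym index)
      (braidᴿ-reverse⇒h m k (subst (λ n → π ∈ S n) swap-km π∈S) π≢π′ descending∈I
        descending-compatible (λ _ → refl)
        (braidᴿ-flip⇒braidᴿ-reverse {ℓ = λ a → m + descending a} π∈S π′∈S
          (λ a → subst (m + descending a ≤_) (ascending+descending k m a) (m≤m+n _ _))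
          (consecutive-descending k m) eq))
  where
  open ≡-Reasoning
  swap-km : k + (4 + m) ≡ m + (4 + k)
  swap-km = solve 2 (λ k m → k :+ (con 4 :+ m) := m :+ (con 4 :+ k)) refl k m
  -- The lowest letter of the complemented window, for `i = 2 + k`.
  index : k + (4 + m) ∸ (2 + k) ∸ 1 ≡ suc m
  index = begin
    k + (4 + m) ∸ (2 + k) ∸ 1
      ≡⟨ cong (λ n → n ∸ (2 + k) ∸ 1)
           (solve 2 (λ k m → k :+ (con 4 :+ m) := con 2 :+ k :+ (con 2 :+ m)) refl k m) ⟩
    (2 + k) + (2 + m) ∸ (2 + k) ∸ 1
      ≡⟨ cong (_∸ 1) (m+n∸m≡n (2 + k) (2 + m)) ⟩
    suc m ∎
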